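{- Consider instances of the Colored Knapsack Problem (ColKP) with $n$ items satisfying $w_i\le b$ and $-p_{\max}<p_i\le p_{\max}$ for all items $i\in\mathcal I$, where $p_{\max}=\max\{p_i:i\in\mathcal I\}>0$, and let $\varepsilon\in(0,1)$. The item-by-item scaling algorithm (Algorithm F1 described in the context) runs in $O(n^5/\varepsilon)$ time when all profits are nonnegative, and in $O(n^6/\varepsilon)$ time for arbitrary integer profits.
   Context: ColKP instance: items $\mathcal I=\{1,\dots,n\}$, capacity $b\in\mathbb Z_{>0}$, colors $\mathcal C=\{1,\dots,m\}$; each item $i$ has weight $w_i\in\mathbb Z_{>0}$, profit $p_i\in\mathbb Z$ and color $\kappa_i\in\mathcal C$. For $S\subseteq\mathcal I$: $w(S)=\sum_{i\in S}w_i$, $p(S)=\sum_{i\in S}p_i$, $\mathcal I_c=\{i\in\mathcal I:\kappa_i=c\}$, $k_c(S)=|S\cap\mathcal I_c|$, $d(S)=\max_{c\in\mathcal C}k_c(S)$. A color $c$ is dominant in $S$ if $k_c(S)=d(S)$. $S$ is color-feasible if $2d(S)\le|S|+1$, and feasible if moreover $w(S)\le b$. The problem asks for a feasible $S$ maximizing $p(S)$. Algorithm LP-Round: (1) compute an optimal basic solution $x^*$ (an optimal extreme point) of the linear program: maximize $\sum_{i}p_ix_i$ subject to $\sum_{i}w_ix_i\le b$, $\sum_{i\in\mathcal I_c}x_i-\sum_{i\in\mathcal I\setminus\mathcal I_c}x_i\le1$ for all $c\in\mathcal C$, $x_i\in[0,1]$ for all $i$, using a subroutine known from earlier work that does this in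 $O(n)$ time; (2) set $S_0=\{i:x_i^*=1\}$; (3) if $S_0$ is not color-feasible, let $c$ be its unique dominant color and remove from $S_0$ an item of $S_0\cap\mathcal I_c$ of minimum profit; (4) return the more profitable of $S_0$ and $\{r\}$, where $r$ is an item with $p_r=p_{\max}$. Algorithm F1 (input: the instance and $\varepsilon$): (1) Run LP-Round, let $\mathrm{LB}$ be the profit of the set it returns, and let $\mathrm{UB}=3\,\mathrm{LB}$. (2) Set $\lambda=\varepsilon\,\mathrm{LB}/n$ and $\hat p_i=\lfloor p_i/\lambda\rfloor$ for all $i$. (3) If all $p_i\ge0$, set $z_{\min}=0$, $z_{\max}=\lceil\mathrm{UB}/\lambda\rceil$; otherwise set $z_{\min}=\lfloor -n\,p_{\max}/\lambda\rfloor$, $z_{\max}=\lceil(\mathrm{UB}+n\,p_{\max})/\lambda\rceil$. (4) Sort (re-index) the items by color, so that each color class is a contiguous block of indices. (5) Run the following dynamic program. Set $g(0,0,0,0,0)=0$ and every other table entry $g(i,t,d,a,z)=+\infty$, where $i,t,d,a\in\{0,\dots,n\}$ and $z\in\{z_{\min},\dots,z_{\max}\}$. For $i=1,\dots,n$ and every $(t,d,a,z)$ with $g(i-1,t,d,a,z)<+\infty$: let $a'=a$ if $i>1$ and $\kappa_i=\kappa_{i-1}$, and $a'=0$ otherwise; set $g(i,t,d,a',z)\leftarrow\min\{g(i,t,d,a',z),\,g(i-1,t,d,a,z)\}$ (do not pack $i$); let $d'=d+1$ if $a'=d$ and $d'=d$ otherwise; and set $g(i,t+1,d',a'+1,z+\hat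 p_i)\leftarrow\min\{g(i,t+1,d',a'+1,z+\hat p_i),\,g(i-1,t,d,a,z)+w_i\}$ (pack $i$), the latter only if $z+\hat p_i\in[z_{\min},z_{\max}]$ and $g(i-1,t,d,a,z)+w_i\le b$. (6) Among all terminal entries with $g(n,t,d,a,z)\le b$ and $2d\le t+1$, choose one with maximum $z$, and return the set recovered by backtracking the transitions leading to it. Running time counts elementary arithmetic operations, comparisons and table accesses.
   Formalization: The accuracy parameter ε is taken to be a rational number in (0,1) rather than an arbitrary real number. -}

module Defs where

open import Data.Bool.Base using (Bool; true; false; if_then_else_; not; _∧_)
open import Data.Fin.Base using (Fin; zero; suc; toℕ)
import Data.Fin.Properties as Fin
open import Data.Fin.Subset using (Subset; inside; outside; ⊥; ⁅_⁆)
open import Data.Integer.Base as ℤ using (ℤ; +_; 0ℤ; 1ℤ)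
import Data.Integer.Properties as ℤ
open import Data.List.Base using (List; []; _∷_; allFin; upTo; applyUpTo)
open import Data.Maybe.Base using (Maybe; just; nothing)
open import Data.Nat.Base as ℕ using (ℕ; zero; suc; NonZero)
import Data.Nat.Properties as ℕ
open import Data.Product.Base using (_×_; _,_; proj₁; proj₂)
open import Data.Product.Properties using (≡-dec)
open import Data.Rational.Base as ℚ using (ℚ; 0ℚ; 1ℚ; floor; ceiling)
import Data.Rational.Properties as ℚ
open import Data.Unit.Base using (⊤; tt)
open import Data.Vec.Base as Vec using (Vec; []; _∷_; lookup; _[_]≔_)
open import Data.Vec.Functional using (Vector; foldr)
open import Algebra.Properties.CommutativeMonoid.Sum ℚ.+-0-commutativeMonoid using (sum)
open import Relation.Binary.Definitions using (DecidableEquality)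
open import Relation.Binary.PropositionalEquality using (_≡_)
open import Relation.Nullary.Decidable using (does; yes; no)

ι : ℤ → ℚ
ι z = z ℚ./ 1

ιℕ : ℕ → ℚ
ιℕ k = ι (+ k)

-- Items are Fin n and colors are Fin m.  There is at least one item, so
-- that the maximum profit exists.
record Instance : Set where
  field
    n m     : ℕ
    ⦃ n≢0 ⦄ : NonZero n
    b       : ℕ
    w       : Vector ℕ n
    p       : Vector ℤ n
    κ       : Vector (Fin m) n
    b>0     : 0 ℕ.< b
    w>0     : ∀ i → 0 ℕ.< w i

firstItem : ∀ {n} → ⦃ NonZero n ⦄ → Fin n
firstItem {suc _} = zero

module _ (I : Instance) where
  open Instance I

  pmax : ℤ
  pmax = foldr ℤ._⊔_ (p firstItem) p

  record Admissible : Set where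
    field
      w≤b     : ∀ i → w i ℕ.≤ b
      -pmax<p : ∀ i → ℤ.- pmax ℤ.< p i
      p≤pmax  : ∀ i → p i ℤ.≤ pmax
      pmax>0  : 0ℤ ℤ.< pmax

  NonnegativeProfits : Set
  NonnegativeProfits = ∀ i → 0ℤ ℤ.≤ p i

  insideColor outsideColor : Fin m → Vector ℚ n → Vector ℚ n
  insideColor  c x i = if does (κ i Fin.≟ c) then x i else 0ℚ
  outsideColor c x i = if does (κ i Fin.≟ c) then 0ℚ else x i

  record LPFeasible (x : Vector ℚ n) : Set where
    field
      capacity : sum (λ i → ιℕ (w i) ℚ.* x i) ℚ.≤ ιℕ b
      color    : ∀ c → sum (insideColor c x) ℚ.- sum (outsideColor c x) ℚ.≤ 1ℚ
      x≥0      : ∀ i → 0ℚ ℚ.≤ x i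
      x≤1      : ∀ i → x i ℚ.≤ 1ℚ

  objective : Vector ℚ n → ℚ
  objective x = sum (λ i → ι (p i) ℚ.* x i)

  -- All data are integers, so every extreme point of the real feasible
  -- polytope is rational, and testing extremality against rational
  -- points only does not change the notion.
  record OptimalExtremePoint (x : Vector ℚ n) : Set where
    field
      feasible : LPFeasible x
      optimal  : ∀ y → LPFeasible y → objective y ℚ.≤ objective x
      extreme  : ∀ y z θ → LPFeasible y → LPFeasible z → 0ℚ ℚ.< θ → θ ℚ.< 1ℚ →
                 (∀ i → x i ≡ θ ℚ.* y i ℚ.+ (1ℚ ℚ.- θ) ℚ.* z i) →
                 ∀ i → y i ≡ x i × z i ≡ x i

-- A computation together with the number of elementary steps it takes.
record Timed (A : Set) : Set where
  constructor _costing_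
  field
    value : A
    cost  : ℕ
open Timed public

return : ∀ {A} → A → Timed A
return x = x costing 0

infixl 1 _>>=_ _>>_

_>>=_ : ∀ {A B} → Timed A → (A → Timed B) → Timed B
(x costing k) >>= f = value (f x) costing (k ℕ.+ cost (f x))

_>>_ : ∀ {A B} → Timed A → Timed B → Timed B
s >> t = s >>= λ _ → t

tick : ℕ → Timed ⊤
tick k = tt costing k

-- One elementary step.  Below, the brackets always enclose exactly one
-- arithmetic operation (on integers or rationals, including floor and
-- ceiling), one comparison, one array read or write, or one list cell
-- allocation; casts along ι and Boolean connectives are not charged.
⟦_⟧ : ∀ {A} → A → Timed A
⟦ x ⟧ = x costing 1

-- Each iteration is charged for advancing and testing the loop variable,
-- and leaving the loop for the final test.
for : ∀ {A S : Set} → List A → S → (A → S → Timed S) → Timed S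
for []       s body = do
  tick 1
  return s
for (x ∷ xs) s body = do
  tick 2
  s′ ← body x s
  for xs s′ body

-- Random-access memory, with unit-cost reads T k and writes.
Table : Set → Set → Set
Table K V = K → V

write : ∀ {K V} → DecidableEquality K → Table K V → K → V → Table K V
write _≟_ T k v k′ = if does (k ≟ k′) then v else T k′

-- Division made total by q ÷₀ 0 = 0; for admissible instances and ε > 0
-- the algorithm never divides by zero.
_÷₀_ : ℚ → ℚ → ℚ
p ÷₀ q with q ℚ.≟ 0ℚ
... | yes _   = 0ℚ
... | no  q≢0 = (p ℚ.÷ q) ⦃ ℚ.≢-nonZero q≢0 ⦄

-- The solver is used as a black box: nothing but its correctness and its
-- linear running time, with a constant K uniform over all instances, is
-- assumed.
record LPSubroutine : Set where
  field
    solve   : (I : Instance) → Timed (Vector ℚ (Instance.n I))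
    correct : ∀ I → Admissible I → OptimalExtremePoint I (value (solve I))
    K       : ℕ
    linear  : ∀ I → Admissible I → cost (solve I) ℕ.≤ K ℕ.* Instance.n I

module _ (I : Instance) where
  open Instance I

  items : List (Fin n)
  items = allFin n

  emptySet : Timed (Subset n)
  emptySet = do
    tick n
    return ⊥

  singleton : Fin n → Timed (Subset n)
  singleton r = do
    S ← emptySet
    ⟦ S [ r ]≔ inside ⟧

  size : Subset n → Timed ℕ
  size S = for items 0 λ i k → do
    i∈S ← ⟦ lookup S i ⟧
    if i∈S then ⟦ suc k ⟧ else return k

  profit : Subset n → Timed ℤ
  profit S = for items 0ℤ λ i s → do
    i∈S ← ⟦ lookup S i ⟧
    if i∈S
      then (do
        pᵢ ← ⟦ p i ⟧
        ⟦ s ℤ.+ pᵢ ⟧)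
      else return s

  hasColor : Fin m → Fin n → Timed Bool
  hasColor c i = do
    κᵢ ← ⟦ κ i ⟧
    ⟦ does (κᵢ Fin.≟ c) ⟧

  -- k_c(S)
  colorCount : Subset n → Fin m → Timed ℕ
  colorCount S c = for items 0 λ i k → do
    i∈S ← ⟦ lookup S i ⟧
    κᵢ≡c ← hasColor c i
    if i∈S ∧ κᵢ≡c then ⟦ suc k ⟧ else return k

  -- d(S) together with a color attaining it.  Only the colors of items
  -- are inspected, since m need not be bounded in terms of n.
  dominant : Subset n → Timed (ℕ × Fin m)
  dominant S = do
    c₀ ← ⟦ κ firstItem ⟧
    for items (0 , c₀) λ where
      i (d , c) → do
        κᵢ ← ⟦ κ i ⟧
        k ← colorCount S κᵢ
        d<k ← ⟦ does (d ℕ.<? k) ⟧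
        if d<k then return (k , κᵢ) else return (d , c)

  balanced : ℕ → ℕ → Timed Bool
  balanced d s = do
    2d ← ⟦ 2 ℕ.* d ⟧
    s+1 ← ⟦ s ℕ.+ 1 ⟧
    ⟦ does (2d ℕ.≤? s+1) ⟧

  lessProfitable : Fin n → Fin n → Timed Bool
  lessProfitable i j = do
    pᵢ ← ⟦ p i ⟧
    pⱼ ← ⟦ p j ⟧
    ⟦ does (pᵢ ℤ.<? pⱼ) ⟧

  cheapestOfColor : Subset n → Fin m → Timed (Maybe (Fin n))
  cheapestOfColor S c = for items nothing λ i best → do
    i∈S ← ⟦ lookup S i ⟧
    κᵢ≡c ← hasColor c i
    if i∈S ∧ κᵢ≡c then improve i best else return best
    where
    improve : Fin n → Maybe (Fin n) → Timed (Maybe (Fin n))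
    improve i nothing  = return (just i)
    improve i (just j) = do
      i<j ← lessProfitable i j
      if i<j then return (just i) else return (just j)

  removeItem : Subset n → Maybe (Fin n) → Timed (Subset n)
  removeItem S nothing  = return S
  removeItem S (just i) = ⟦ S [ i ]≔ outside ⟧

  repair : Subset n → Timed (Subset n)
  repair S = do
    (d , c) ← dominant S
    s ← size S
    feasible ← balanced d s
    if feasible
      then return S
      else (do
        i ← cheapestOfColor S c
        removeItem S i)

  mostProfitableItem : Timed (Fin n)
  mostProfitableItem = for items firstItem λ i r → do
    r<i ← lessProfitable r i
    if r<i then return i else return r

  integralPart : Vector ℚ n → Timed (Subset n)
  integralPart x = do
    ∅ ← emptySet
    for items ∅ λ i S → do
      xᵢ ← ⟦ x i ⟧
      xᵢ≡1 ← ⟦ does (xᵢ ℚ.≟ 1ℚ) ⟧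
      if xᵢ≡1 then ⟦ S [ i ]≔ inside ⟧ else return S

  lpRound : LPSubroutine → Timed (Subset n)
  lpRound lp = do
    x ← LPSubroutine.solve lp I
    S ← integralPart x
    S₀ ← repair S
    r ← mostProfitableItem
    R ← singleton r
    pS₀ ← profit S₀
    pᵣ ← ⟦ p r ⟧
    pS₀<pᵣ ← ⟦ does (pS₀ ℤ.<? pᵣ) ⟧
    if pS₀<pᵣ then return R else return S₀

  insert : ∀ {k} → Fin n → Vec (Fin n) k → Timed (Vec (Fin n) (suc k))
  insert i []       = ⟦ i ∷ [] ⟧
  insert i (j ∷ js) = do
    κᵢ ← ⟦ κ i ⟧
    κⱼ ← ⟦ κ j ⟧
    κᵢ≤κⱼ ← ⟦ does (κᵢ Fin.≤? κⱼ) ⟧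
    if κᵢ≤κⱼ
      then ⟦ i ∷ j ∷ js ⟧
      else (do
        js′ ← insert i js
        ⟦ j ∷ js′ ⟧)

  -- Insertion sort: its quadratic cost is dominated by the dynamic program.
  sortByColor : ∀ {k} → Vec (Fin n) k → Timed (Vec (Fin n) k)
  sortByColor []       = ⟦ [] ⟧
  sortByColor (i ∷ is) = do
    tick 2
    is′ ← sortByColor is
    insert i is′

-- (t , d , a , z); a table index is such a tuple preceded by i.
Cell Index : Set
Cell  = ℕ × ℕ × ℕ × ℤ
Index = ℕ × Cell

_≟ᴵ_ : DecidableEquality Index
_≟ᴵ_ = ≡-dec ℕ._≟_ (≡-dec ℕ._≟_ (≡-dec ℕ._≟_ (≡-dec ℕ._≟_ ℤ._≟_)))

-- nothing stands for +∞.
ℕ∞ : Set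
ℕ∞ = Maybe ℕ

_<∞?_ : ℕ → ℕ∞ → Bool
v <∞? nothing = true
v <∞? just u  = does (v ℕ.<? u)

_∞≤?_ : ℕ∞ → ℕ → Bool
nothing ∞≤? u = false
just v  ∞≤? u = does (v ℕ.≤? u)

-- The values g, and for backtracking, the cell of layer i - 1 from which
-- the current value of an entry of layer i was obtained together with
-- whether item i was packed.
Tables : Set
Tables = Table Index ℕ∞ × Table Index (Bool × Cell)

range : ℤ → ℤ → List ℤ
range lo hi = applyUpTo (λ k → lo ℤ.+ + k) (length (ℤ.suc (hi ℤ.- lo)))
  where
  length : ℤ → ℕ
  length (+ k)        = k
  length ℤ.-[1+ _ ] = 0

module DP (I : Instance) (p̂ : Table (Fin (Instance.n I)) ℤ) (zmin zmax : ℤ) where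
  open Instance I

  forCells : ∀ {S : Set} → S → (Cell → S → Timed S) → Timed S
  forCells s body =
    for (upTo (suc n)) s λ t s →
    for (upTo (suc n)) s λ d s →
    for (upTo (suc n)) s λ a s →
    for (range zmin zmax) s λ z s →
    body (t , d , a , z) s

  initialize : Timed Tables
  initialize = do
    g ← for (upTo (suc n)) (λ _ → nothing) λ i g →
        forCells g λ c g →
        ⟦ write _≟ᴵ_ g (i , c) nothing ⟧
    g ← ⟦ write _≟ᴵ_ g (0 , 0 , 0 , 0 , 0ℤ) (just 0) ⟧
    return (g , λ _ → false , 0 , 0 , 0 , 0ℤ)

  relax : Index → ℕ → Bool × Cell → Tables → Timed Tables
  relax k v from (g , π) = do
    old ← ⟦ g k ⟧
    v<old ← ⟦ v <∞? old ⟧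
    if v<old
      then (do
        g ← ⟦ write _≟ᴵ_ g k (just v) ⟧
        π ← ⟦ write _≟ᴵ_ π k from ⟧
        return (g , π))
      else return (g , π)

  pack : ℕ → Fin n → ℕ → ℕ → Cell → Tables → Timed Tables
  pack i j a′ v (t , d , a , z) T = do
    a′≡d ← ⟦ does (a′ ℕ.≟ d) ⟧
    d′ ← if a′≡d then ⟦ d ℕ.+ 1 ⟧ else return d
    p̂ⱼ ← ⟦ p̂ j ⟧
    z′ ← ⟦ z ℤ.+ p̂ⱼ ⟧
    zmin≤z′ ← ⟦ does (zmin ℤ.≤? z′) ⟧
    z′≤zmax ← ⟦ does (z′ ℤ.≤? zmax) ⟧
    wⱼ ← ⟦ w j ⟧
    v′ ← ⟦ v ℕ.+ wⱼ ⟧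
    v′≤b ← ⟦ does (v′ ℕ.≤? b) ⟧
    t+1 ← ⟦ t ℕ.+ 1 ⟧
    a′+1 ← ⟦ a′ ℕ.+ 1 ⟧
    if zmin≤z′ ∧ z′≤zmax ∧ v′≤b
      then relax (i , t+1 , d′ , a′+1 , z′) v′ (true , t , d , a , z) T
      else return T

  -- The transitions out of entry (i - 1 , c) whose value is given; j is
  -- the i-th item in the sorted order, and sameColor tells whether it
  -- has a predecessor, of the same color.
  transitions : ℕ → Fin n → Bool → Cell → ℕ∞ → Tables → Timed Tables
  transitions i j sameColor c               nothing  T = return T
  transitions i j sameColor (t , d , a , z) (just v) T = do
    let a′ = if sameColor then a else 0
    T ← relax (i , t , d , a′ , z) v (false , t , d , a , z) T
    pack i j a′ v (t , d , a , z) T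

  continuesColor : Maybe (Fin n) → Fin n → Timed Bool
  continuesColor nothing  j = return false
  continuesColor (just h) j = do
    κₕ ← ⟦ κ h ⟧
    hasColor I κₕ j

  -- Processes the remaining items, given the index i - 1 of the last
  -- completed layer and the item preceding them.
  fill : ∀ {k} → ℕ → Maybe (Fin n) → Vec (Fin n) k → Tables → Timed Tables
  fill i-1 h []       T = do
    tick 1
    return T
  fill i-1 h (j ∷ js) T = do
    tick 2
    i ← ⟦ i-1 ℕ.+ 1 ⟧
    T ← forCells T λ c T → do
      v ← ⟦ proj₁ T (i-1 , c) ⟧
      sameColor ← continuesColor h j
      tick 1 -- the comparison of v with +∞
      transitions i j sameColor c v T
    fill i (just j) js T

  keepBest : Cell → Maybe Cell → Timed (Maybe Cell)
  keepBest c nothing = return (just c)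
  keepBest c@(_ , _ , _ , z) (just c′@(_ , _ , _ , z′)) = do
    z′<z ← ⟦ does (z′ ℤ.<? z) ⟧
    if z′<z then return (just c) else return (just c′)

  bestTerminal : Table Index ℕ∞ → Timed (Maybe Cell)
  bestTerminal g = forCells nothing λ where
    c@(t , d , a , z) best → do
      v ← ⟦ g (n , c) ⟧
      v≤b ← ⟦ v ∞≤? b ⟧
      feasible ← balanced I d t
      if v≤b ∧ feasible then keepBest c best else return best

  -- For the items after layer i, and a terminal cell: the set of those
  -- packed on the path to that cell, and the cell of layer i on it.
  backtrack : ∀ {k} → Table Index (Bool × Cell) → ℕ → Vec (Fin n) k → Cell →
              Timed (Subset n × Cell)
  backtrack π i []       c = do
    ∅ ← emptySet I
    return (∅ , c)
  backtrack π i (j ∷ js) c = do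
    tick 2
    i+1 ← ⟦ i ℕ.+ 1 ⟧
    (S , c′) ← backtrack π i+1 js c
    (packed , c″) ← ⟦ π (i+1 , c′) ⟧
    if packed
      then (do
        S ← ⟦ S [ j ]≔ inside ⟧
        return (S , c″))
      else return (S , c″)

  recover : Table Index (Bool × Cell) → Vec (Fin n) n → Maybe Cell → Timed (Subset n)
  recover π σ nothing  = emptySet I
  recover π σ (just c) = do
    (S , _) ← backtrack π 0 σ c
    return S

  run : Vec (Fin n) n → Timed (Subset n)
  run σ = do
    T ← initialize
    (g , π) ← fill 0 nothing σ T
    c ← bestTerminal g
    recover π σ c

module _ (I : Instance) where
  open Instance I

  scaledProfits : ℚ → Timed (Table (Fin n) ℤ)
  scaledProfits scale = for (items I) (λ _ → 0ℤ) λ i p̂ → do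
    pᵢ ← ⟦ p i ⟧
    q ← ⟦ ι pᵢ ÷₀ scale ⟧
    p̂ᵢ ← ⟦ floor q ⟧
    ⟦ write Fin._≟_ p̂ i p̂ᵢ ⟧

  allNonnegative : Timed Bool
  allNonnegative = for (items I) true λ i ok → do
    pᵢ ← ⟦ p i ⟧
    pᵢ≥0 ← ⟦ does (0ℤ ℤ.≤? pᵢ) ⟧
    return (ok ∧ pᵢ≥0)

  profitRange : ℚ → ℤ → Timed (ℤ × ℤ)
  profitRange scale UB = do
    nonneg ← allNonnegative
    if nonneg
      then (do
        u ← ⟦ ι UB ÷₀ scale ⟧
        zmax ← ⟦ ceiling u ⟧
        return (0ℤ , zmax))
      else (do
        r ← mostProfitableItem I
        pᵣ ← ⟦ p r ⟧
        npᵣ ← ⟦ + n ℤ.* pᵣ ⟧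
        -npᵣ ← ⟦ ℤ.- npᵣ ⟧
        l ← ⟦ ι -npᵣ ÷₀ scale ⟧
        zmin ← ⟦ floor l ⟧
        UB+npᵣ ← ⟦ UB ℤ.+ npᵣ ⟧
        u ← ⟦ ι UB+npᵣ ÷₀ scale ⟧
        zmax ← ⟦ ceiling u ⟧
        return (zmin , zmax))

  F1 : LPSubroutine → ℚ → Timed (Subset n)
  F1 lp ε = do
    S ← lpRound I lp
    LB ← profit I S
    UB ← ⟦ + 3 ℤ.* LB ⟧
    εLB ← ⟦ ε ℚ.* ι LB ⟧
    scale ← ⟦ εLB ÷₀ ιℕ n ⟧
    p̂ ← scaledProfits scale
    (zmin , zmax) ← profitRange scale UB
    σ ← sortByColor I (Vec.allFin n)
    DP.run I p̂ zmin zmax σ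

  runningTime : LPSubroutine → ℚ → ℕ
  runningTime lp ε = cost (F1 lp ε)

_^_over_ : ℕ → ℕ → (ε : ℚ) → .⦃ ℚ.Positive ε ⦄ → ℚ
n ^ e over ε = (ιℕ (n ℕ.^ e) ℚ.÷ ε) ⦃ ℚ.pos⇒nonZero ε ⦄

{-# OPTIONS --safe #-}

-- The dynamic program touches (n + 1)⁴ M table entries, with M the number of
-- admissible profit values z, each in constant time, and this dominates all
-- other steps.  So everything rests on bounding M.  LP-Round returns a set at
-- least as profitable as the best single item, hence LB ≥ pmax > 0.  With
-- scale = ε LB / n this gives UB / scale = 3 n / ε and n pmax / scale ≤ n² / ε,
-- so M is O(n / ε) for nonnegative profits and O(n² / ε) in general.
module Submission where

open import Defs
open import Data.Bool.Base using (Bool; true; false; if_then_else_; _∧_)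
open import Data.Fin.Base using (Fin; zero; suc)
import Data.Fin.Properties as Fin
open import Data.Fin.Subset using (Subset; inside; outside; ⊥)
open import Data.Integer.Base as ℤ using (ℤ; +_; 0ℤ; 1ℤ; -1ℤ)
import Data.Integer.DivMod as ℤ
import Data.Integer.Properties as ℤ
import Data.Integer.Tactic.RingSolver as ℤ
open import Data.List.Base using (List; []; _∷_; length; upTo)
open import Data.List.Membership.Propositional using (_∈_)
open import Data.List.Membership.Propositional.Properties using (∈-allFin)
open import Data.List.Properties using (length-applyUpTo; length-tabulate; length-upTo)
open import Data.List.Relation.Unary.All as All using (All; []; _∷_)
open import Data.List.Relation.Unary.AllPairs using (_∷_)
open import Data.List.Relation.Unary.Any using (here; there)
open import Data.List.Relation.Unary.Unique.Propositional using (Unique)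
open import Data.List.Relation.Unary.Unique.Propositional.Properties using (allFin⁺)
open import Data.Maybe.Base using (just; nothing)
open import Data.Nat.Base as ℕ using (ℕ; zero; suc; NonZero; z≤n; s≤s; >-nonZero)
import Data.Nat.Properties as ℕ
import Data.Nat.Tactic.RingSolver as ℕ
open import Data.Product.Base using (_×_; _,_; proj₁; proj₂; ∃-syntax)
open import Data.Rational.Base as ℚ using (ℚ; 0ℚ; 1ℚ; Positive; ↥_; ↧_; floor; ceiling; toℚᵘ)
import Data.Rational.Properties as ℚ
open import Data.Rational.Solver using (module +-*-Solver)
open import Data.Rational.Unnormalised.Base as ℚᵘ using (mkℚᵘ)
import Data.Rational.Unnormalised.Properties as ℚᵘ
open import Data.Sum.Base using (_⊎_; inj₁; inj₂)
open import Data.Vec.Base as Vec using (Vec; []; _∷_; lookup; _[_]≔_)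
open import Data.Vec.Functional using (Vector; foldr)
open import Data.Vec.Properties using (lookup∘update; lookup∘update′; lookup-replicate)
open import Function.Base using (_∘_)
open import Relation.Binary.PropositionalEquality
  using (_≡_; _≢_; refl; cong; cong₂; sym; ≢-sym; trans; subst; module ≡-Reasoning)
open import Relation.Nullary.Decidable using (does; yes; no; dec-true; toWitness)
open import Relation.Nullary.Negation using (contradiction)

-- Cost bounds for sums, branches and loops.

module Costs where

  open import Data.Nat.Base using (_+_; _*_; _≤_)
  open import Data.Nat.Properties
  open import Data.Nat.Tactic.RingSolver using (solve-∀)

  infix 4 _≤_∙_
  infixr 5 _⊕_

  -- A record, because unification cannot recover c and N from c * N.
  record _≤_∙_ (x c N : ℕ) : Set where
    constructor bound
    field bounded : x ≤ c * N
  open _≤_∙_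

  lit : ∀ c {N} → 1 ≤ N → c ≤ c ∙ N
  lit c 1≤N = bound (m≤m*n c _ ⦃ >-nonZero 1≤N ⦄)

  _⊕_ : ∀ {x y a b N} → x ≤ a ∙ N → y ≤ b ∙ N → x + y ≤ a + b ∙ N
  _⊕_ {a = a} {b} {N} (bound x≤) (bound y≤) =
    bound (≤-trans (+-mono-≤ x≤ y≤) (≤-reflexive (sym (*-distribʳ-+ N a b))))

  below : ∀ {x y c N} → x ≤ y → y ≤ c ∙ N → x ≤ c ∙ N
  below x≤y (bound y≤) = bound (≤-trans x≤y y≤)

  coarsen : ∀ {x c d N} → c ≤ d → x ≤ c ∙ N → x ≤ d ∙ N
  coarsen {N = N} c≤d (bound x≤) = bound (≤-trans x≤ (*-monoˡ-≤ N c≤d))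

  -- The cost of a conditional does not reduce while its test is unknown, so both branches are held
  -- to a common bound.
  if-≤ : ∀ {A : Set} (β : Bool) {s t : Timed A} {k} →
         cost s ≤ k → cost t ≤ k → cost (if β then s else t) ≤ k
  if-≤ true  s≤k t≤k = s≤k
  if-≤ false s≤k t≤k = t≤k

  if-cost : ∀ {A : Set} (β : Bool) {s t : Timed A} {c N} →
            cost s ≤ c ∙ N → cost t ≤ c ∙ N → cost (if β then s else t) ≤ c ∙ N
  if-cost β (bound s≤) (bound t≤) = bound (if-≤ β s≤ t≤)

  module _ {A S : Set} where

    -- The loop charges 2 per iteration, besides the body, and 1 for the final test.
    for-cost-length : ∀ (xs : List A) (s : S) {body} k → (∀ x s → cost (body x s) ≤ k) →
                      cost (for xs s body) ≤ 1 + length xs * (2 + k)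
    for-cost-length []       s k body≤ = ≤-refl
    for-cost-length (x ∷ xs) s {body} k body≤ = begin
      2 + (cost (body x s) + cost (for xs (value (body x s)) body))
        ≤⟨ +-monoʳ-≤ 2 (+-mono-≤ (body≤ x s) (for-cost-length xs _ k body≤)) ⟩
      2 + (k + (1 + length xs * (2 + k)))
        ≡⟨ shuffle k (length xs * (2 + k)) ⟩
      1 + length (x ∷ xs) * (2 + k) ∎
      where
      open ≤-Reasoning
      shuffle : ∀ k l → 2 + (k + (1 + l)) ≡ 1 + (2 + k + l)
      shuffle = solve-∀

    -- The measure `M` of the body stays a factor, so that nested loops multiply their lengths. The
    -- constant grows by 3: 2 for advancing, absorbed by `1 ≤ M`, and 1 for the final test, absorbed
    -- by `1 ≤ M * N`.
    for-cost : ∀ (xs : List A) {s : S} {body N M} c → length xs ≤ N → 1 ≤ N → 1 ≤ M →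
               (∀ x s → cost (body x s) ≤ c ∙ M) →
               cost (for xs s body) ≤ 3 + c ∙ M * N
    for-cost xs {s} {body} {N} {M} c xs≤N 1≤N 1≤M body≤ = bound (begin
      cost (for xs s body)           ≤⟨ for-cost-length xs s (c * M) (λ x s → bounded (body≤ x s)) ⟩
      1 + length xs * (2 + c * M)    ≤⟨ +-mono-≤ (*-mono-≤ 1≤M 1≤N) (*-mono-≤ xs≤N (+-monoˡ-≤ (c * M) (bounded (lit 2 1≤M)))) ⟩
      M * N + N * (2 * M + c * M)    ≡⟨ shuffle M N c ⟩
      (3 + c) * (M * N)              ∎)
      where
      open ≤-Reasoning
      shuffle : ∀ M N c → M * N + N * (2 * M + c * M) ≡ (3 + c) * (M * N)
      shuffle = solve-∀

    for-cost₁ : ∀ (xs : List A) {s : S} {body N} c → length xs ≤ N → 1 ≤ N →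
                (∀ x s → cost (body x s) ≤ c) →
                cost (for xs s body) ≤ 3 + c ∙ N
    for-cost₁ xs {s} {body} {N} c xs≤N 1≤N body≤ = bound (≤-trans
      (bounded (for-cost xs {M = 1} c xs≤N 1≤N ≤-refl λ x s → below (body≤ x s) (lit c ≤-refl)))
      (≤-reflexive (cong ((3 + c) *_) (*-identityˡ N))))

  -- Costs of the routines outside the dynamic program.

  module RoutineCosts (I : Instance) where
    open Instance I

    N N² : ℕ
    N  = suc n
    N² = N * N

    1≤N : 1 ≤ N
    1≤N = s≤s z≤n

    1≤N² : 1 ≤ N²
    1≤N² = s≤s z≤n

    n≤N : n ≤ N
    n≤N = n≤1+n n

    #items≤N : length (items I) ≤ N
    #items≤N = ≤-trans (≤-reflexive (length-tabulate {n = n} (λ i → i))) n≤N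

    linear⇒quadratic : ∀ {x c} → x ≤ c ∙ N → x ≤ c ∙ N²
    linear⇒quadratic {c = c} (bound x≤) = bound (≤-trans x≤ (*-monoʳ-≤ c (m≤m*n N N)))

    emptySet-cost : cost (emptySet I) ≤ 1 ∙ N
    emptySet-cost = bound (+-mono-≤ n≤N z≤n)

    singleton-cost : ∀ r → cost (singleton I r) ≤ 2 ∙ N
    singleton-cost r = emptySet-cost ⊕ lit 1 1≤N

    size-cost : ∀ S → cost (size I S) ≤ 5 ∙ N
    size-cost S = for-cost₁ (items I) 2 #items≤N 1≤N λ i k → s≤s (if-≤ (lookup S i) ≤-refl z≤n)

    profit-cost : ∀ S → cost (profit I S) ≤ 6 ∙ N
    profit-cost S = for-cost₁ (items I) 3 #items≤N 1≤N λ i s → s≤s (if-≤ (lookup S i) ≤-refl z≤n)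

    selected : Subset n → Fin m → Fin n → Bool
    selected S c i = lookup S i ∧ does (κ i Fin.≟ c)

    colorCount-cost : ∀ S c → cost (colorCount I S c) ≤ 7 ∙ N
    colorCount-cost S c = for-cost₁ (items I) 4 #items≤N 1≤N λ i k →
      s≤s (s≤s (s≤s (if-≤ (selected S c i) ≤-refl z≤n)))

    -- Quadratic, since a full color count is made for every item.
    dominant-cost : ∀ S → cost (dominant I S) ≤ 13 ∙ N²
    dominant-cost S = lit 1 1≤N² ⊕
      for-cost (items I) 9 #items≤N 1≤N 1≤N λ where
        i (d , c) → lit 1 1≤N ⊕ colorCount-cost S (κ i) ⊕
          below (s≤s (if-≤ (does (d <? value (colorCount I S (κ i)))) ≤-refl z≤n)) (lit 1 1≤N)

    cheapestOfColor-cost : ∀ S c → cost (cheapestOfColor I S c) ≤ 9 ∙ N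
    cheapestOfColor-cost S c = for-cost₁ (items I) 6 #items≤N 1≤N λ where
      i nothing  → s≤s (s≤s (s≤s (if-≤ (selected S c i) z≤n z≤n)))
      i (just j) → s≤s (s≤s (s≤s (if-≤ (selected S c i)
        (s≤s (s≤s (s≤s (if-≤ (does (p i ℤ.<? p j)) z≤n z≤n)))) z≤n)))

    removeItem-cost : ∀ S i → cost (removeItem I S i) ≤ 1 ∙ N
    removeItem-cost S nothing  = bound z≤n
    removeItem-cost S (just i) = lit 1 1≤N

    repair-cost : ∀ S → cost (repair I S) ≤ 31 ∙ N²
    repair-cost S = dominant-cost S ⊕ linear⇒quadratic (size-cost S ⊕ lit 3 1≤N ⊕
      if-cost (value (balanced I d (value (size I S)))) (bound z≤n)
        (cheapestOfColor-cost S c ⊕ removeItem-cost S (value (cheapestOfColor I S c))))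
      where
      d = proj₁ (value (dominant I S))
      c = proj₂ (value (dominant I S))

    mostProfitableItem-cost : cost (mostProfitableItem I) ≤ 6 ∙ N
    mostProfitableItem-cost = for-cost₁ (items I) 3 #items≤N 1≤N λ i r →
      s≤s (s≤s (s≤s (if-≤ (does (p r ℤ.<? p i)) z≤n z≤n)))

    integralPart-cost : ∀ x → cost (integralPart I x) ≤ 7 ∙ N
    integralPart-cost x = emptySet-cost ⊕ for-cost₁ (items I) 3 #items≤N 1≤N λ i S →
      s≤s (s≤s (if-≤ (does (x i ℚ.≟ 1ℚ)) ≤-refl z≤n))

    insert-cost : ∀ {k} i (js : Vec (Fin n) k) → cost (insert I i js) ≤ 1 + k * 4
    insert-cost i []       = ≤-refl
    insert-cost i (j ∷ js) = s≤s (s≤s (s≤s (if-≤ (does (κ i Fin.≤? κ j)) (s≤s z≤n)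
      (≤-trans (+-monoˡ-≤ 1 (insert-cost i js)) (≤-reflexive (+-comm _ 1))))))

    sortByColor-cost : ∀ {k} (is : Vec (Fin n) k) → cost (sortByColor I is) ≤ 1 + k * (3 + k * 4)
    sortByColor-cost []                 = ≤-refl
    sortByColor-cost {suc k} (i ∷ is) = begin
      2 + (cost (sortByColor I is) + cost (insert I i (value (sortByColor I is))))
        ≤⟨ +-monoʳ-≤ 2 (+-mono-≤ (sortByColor-cost is) (insert-cost i (value (sortByColor I is)))) ⟩
      2 + ((1 + k * (3 + k * 4)) + (1 + k * 4))
        -- The added term is exactly the slack left by the closed form.
        ≤⟨ m≤m+n _ (4 + k * 4) ⟩
      2 + ((1 + k * (3 + k * 4)) + (1 + k * 4)) + (4 + k * 4)
        ≡⟨ shuffle k ⟩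
      1 + suc k * (3 + suc k * 4) ∎
      where
      open ≤-Reasoning
      shuffle : ∀ k → 2 + ((1 + k * (3 + k * 4)) + (1 + k * 4)) + (4 + k * 4) ≡ 1 + suc k * (3 + suc k * 4)
      shuffle = solve-∀

    sortAll-cost : (is : Vec (Fin n) n) → cost (sortByColor I is) ≤ 8 ∙ N²
    sortAll-cost is = bound (≤-trans (sortByColor-cost is)
      (≤-trans (m≤m+n _ (7 + n * (13 + n * 4))) (≤-reflexive (shuffle n))))
      where
      shuffle : ∀ n → 1 + n * (3 + n * 4) + (7 + n * (13 + n * 4)) ≡ 8 * (suc n * suc n)
      shuffle = solve-∀

    scaledProfits-cost : ∀ scale → cost (scaledProfits I scale) ≤ 7 ∙ N
    scaledProfits-cost scale = for-cost₁ (items I) 4 #items≤N 1≤N λ i p̂ → ≤-refl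

    allNonnegative-cost : cost (allNonnegative I) ≤ 5 ∙ N
    allNonnegative-cost = for-cost₁ (items I) 2 #items≤N 1≤N λ i ok → ≤-refl

    profitRange-cost : ∀ scale UB → cost (profitRange I scale UB) ≤ 19 ∙ N
    profitRange-cost scale UB = allNonnegative-cost ⊕
      -- The nonnegative branch takes 2 steps; 12 pads this to the constant 14 of the other branch.
      if-cost (value (allNonnegative I)) (coarsen (m≤m+n 2 12) (lit 2 1≤N))
        (mostProfitableItem-cost ⊕ lit 8 1≤N)

    module _ (lp : LPSubroutine) (adm : Admissible I) where
      open LPSubroutine lp

      -- The subroutine contributes its constant `K` per item; the quadratic term comes from
      -- `repair`.
      lpRound-cost : cost (lpRound I lp) ≤ K + 54 ∙ N²
      lpRound-cost =
        linear⇒quadratic (below (linear I adm) (bound (*-monoʳ-≤ K n≤N))) ⊕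
        linear⇒quadratic (integralPart-cost x) ⊕
        repair-cost S ⊕
        linear⇒quadratic (mostProfitableItem-cost ⊕ singleton-cost r ⊕ profit-cost S₀ ⊕
          below (s≤s (s≤s (if-≤ (does (value (profit I S₀) ℤ.<? p r)) z≤n z≤n))) (lit 2 1≤N))
        where
        x = value (solve I)
        S = value (integralPart I x)
        S₀ = value (repair I S)
        r = value (mostProfitableItem I)

  -- Size of the table and cost of the dynamic program.

  module TableSize (I : Instance) (zmin zmax : ℤ) where
    open RoutineCosts I using (N; N²)

    -- One more than the number of profit values, hence positive even if the range is empty.
    L : ℕ
    L = suc (length (range zmin zmax))

    cells layers : ℕ
    cells  = L * N * N * N
    layers = cells * N

    N≤layers : N ≤ layers
    N≤layers = m≤n*m N cells

    N²≤layers : N² ≤ layers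
    N²≤layers = *-monoˡ-≤ N (m≤n*m N (L * N * N))

  module DPCosts (I : Instance) (p̂ : Table (Fin (Instance.n I)) ℤ) (zmin zmax : ℤ) where
    open Instance I
    open RoutineCosts I
    open TableSize I zmin zmax
    open DP I p̂ zmin zmax

    1≤cells : 1 ≤ cells
    1≤cells = s≤s z≤n

    #upTo≤N : length (upTo N) ≤ N
    #upTo≤N = ≤-reflexive (length-upTo N)

    -- Each of the four nested loops adds 3 to the constant. The loop over `z` contributes the
    -- factor `L`, the other three contribute `N` each.
    forCells-cost : ∀ {S : Set} {s : S} body k → (∀ c s → cost (body c s) ≤ k) →
                    cost (forCells s body) ≤ 12 + k ∙ cells
    forCells-cost body k body≤ =
      for-cost (upTo N) (9 + k) #upTo≤N 1≤N (s≤s z≤n) λ t s →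
      for-cost (upTo N) (6 + k) #upTo≤N 1≤N (s≤s z≤n) λ d s →
      for-cost (upTo N) (3 + k) #upTo≤N 1≤N (s≤s z≤n) λ a s →
      for-cost₁ (range zmin zmax) k (n≤1+n _) (s≤s z≤n) λ z s →
      body≤ (t , d , a , z) s

    cells⇒layers : ∀ {x c} → x ≤ c ∙ cells → x ≤ c ∙ layers
    cells⇒layers {c = c} (bound x≤) = bound (≤-trans x≤ (*-monoʳ-≤ c (m≤m*n cells N)))

    initialize-cost : cost initialize ≤ 17 ∙ layers
    initialize-cost =
      for-cost (upTo N) 13 #upTo≤N 1≤N 1≤cells (λ i g → forCells-cost _ 1 λ c g → ≤-refl) ⊕
      lit 1 (s≤s z≤n)

    relax-cost : ∀ k v from T → cost (relax k v from T) ≤ 4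
    relax-cost k v from (g , π) = s≤s (s≤s (if-≤ (v <∞? g k) ≤-refl z≤n))

    pack-cost : ∀ i j a′ v c T → cost (pack i j a′ v c T) ≤ 15
    -- 1 for the test of `a′` against `d`, at most 1 for raising `d`, 9 for the reads, sums and
    -- comparisons that follow, and at most 4 for `relax`.
    pack-cost i j a′ v (t , d , a , z) T = s≤s (+-mono-≤ {_} {1}
      (if-≤ (does (a′ ≟ d)) ≤-refl z≤n)
      (+-monoʳ-≤ 9 (if-≤ (does (zmin ℤ.≤? z′) ∧ does (z′ ℤ.≤? zmax) ∧ does (v + w j ≤? b))
        (relax-cost _ _ _ T) z≤n)))
      where z′ = z ℤ.+ p̂ j

    transitions-cost : ∀ i j sameColor c v T → cost (transitions i j sameColor c v T) ≤ 19
    transitions-cost i j sameColor c nothing  T = z≤n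
    transitions-cost i j sameColor c (just v) T =
      +-mono-≤ (relax-cost _ _ _ T) (pack-cost i j _ v c _)

    continuesColor-cost : ∀ h j → cost (continuesColor h j) ≤ 3
    continuesColor-cost nothing  j = z≤n
    continuesColor-cost (just h) j = ≤-refl

    -- A layer visits every cell in at most 24 steps, which with the loop overhead gives
    -- `36 * cells`; the 3 steps for advancing and computing the index are absorbed by `1 ≤ cells`.
    fill-cost : ∀ {k} i h (js : Vec (Fin n) k) T → cost (fill i h js T) ≤ 1 + k * (39 * cells)
    fill-cost i h []               T = ≤-refl
    fill-cost {suc k} i h (j ∷ js) T = begin
      cost (fill i h (j ∷ js) T)
        ≤⟨ +-monoʳ-≤ 3 (+-mono-≤ (bounded (forCells-cost _ 24 λ c T →
             s≤s (+-mono-≤ (continuesColor-cost h j) (s≤s (transitions-cost (i + 1) j (value (continuesColor h j)) c (proj₁ T (i , c)) T)))))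
             (fill-cost (i + 1) (just j) js _)) ⟩
      3 + (36 * cells + (1 + k * (39 * cells)))
        ≤⟨ +-monoˡ-≤ _ (bounded (lit 3 1≤cells)) ⟩
      3 * cells + (36 * cells + (1 + k * (39 * cells)))
        ≡⟨ shuffle cells (k * (39 * cells)) ⟩
      1 + suc k * (39 * cells) ∎
      where
      open ≤-Reasoning
      shuffle : ∀ c l → 3 * c + (36 * c + (1 + l)) ≡ 1 + (39 * c + l)
      shuffle = solve-∀

    fillAll-cost : ∀ σ T → cost (fill {n} 0 nothing σ T) ≤ 40 ∙ layers
    fillAll-cost σ T = below (fill-cost 0 nothing σ T) (lit 1 (s≤s z≤n) ⊕ bound (begin
      n * (39 * cells)   ≤⟨ *-monoˡ-≤ (39 * cells) n≤N ⟩
      N * (39 * cells)   ≡⟨ shuffle N cells ⟩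
      39 * layers        ∎))
      where
      open ≤-Reasoning
      shuffle : ∀ N c → N * (39 * c) ≡ 39 * (c * N)
      shuffle = solve-∀

    keepBest-cost : ∀ c best → cost (keepBest c best) ≤ 1
    keepBest-cost c                     nothing                    = z≤n
    keepBest-cost c@(_ , _ , _ , z) (just c′@(_ , _ , _ , z′)) =
      s≤s (if-≤ (does (z′ ℤ.<? z)) z≤n z≤n)

    bestTerminal-cost : ∀ g → cost (bestTerminal g) ≤ 18 ∙ cells
    bestTerminal-cost g = forCells-cost _ 6 λ where
      c@(t , d , a , z) best → +-monoʳ-≤ 5
        (if-≤ ((g (n , c) ∞≤? b) ∧ value (balanced I d t)) (keepBest-cost c best) z≤n)

    -- `n` pays for the empty set at the end of the recursion, and 5 for each item.
    backtrack-cost : ∀ {k} π i (js : Vec (Fin n) k) c → cost (backtrack π i js c) ≤ n + k * 5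
    backtrack-cost π i []               c = ≤-reflexive (+-identityʳ _)
    backtrack-cost {suc k} π i (j ∷ js) c = begin
      cost (backtrack π i (j ∷ js) c)
        ≤⟨ +-monoʳ-≤ 3 (+-mono-≤ (backtrack-cost π (i + 1) js c)
             (s≤s (if-≤ (proj₁ (π (i + 1 , proj₂ (value (backtrack π (i + 1) js c))))) ≤-refl z≤n))) ⟩
      3 + ((n + k * 5) + 2)
        ≡⟨ shuffle n (k * 5) ⟩
      n + suc k * 5 ∎
      where
      open ≤-Reasoning
      shuffle : ∀ n l → 3 + ((n + l) + 2) ≡ n + (5 + l)
      shuffle = solve-∀

    recover-cost : ∀ π σ c → cost (recover π σ c) ≤ 6 ∙ N
    recover-cost π σ nothing  = coarsen (s≤s z≤n) emptySet-cost
    recover-cost π σ (just c) = below (+-monoˡ-≤ 0 (backtrack-cost π 0 σ c)) (bound (begin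
      n + n * 5 + 0   ≡⟨ shuffle n ⟩
      6 * n           ≤⟨ *-monoʳ-≤ 6 n≤N ⟩
      6 * N           ∎))
      where
      open ≤-Reasoning
      shuffle : ∀ n → n + n * 5 + 0 ≡ 6 * n
      shuffle = solve-∀

    -- Initialization and filling sweep all layers, the search for the best terminal cell sweeps
    -- one, and backtracking is linear.
    run-cost : ∀ σ → cost (run σ) ≤ 81 ∙ layers
    run-cost σ = initialize-cost ⊕ fillAll-cost σ (value initialize) ⊕ cells⇒layers (bestTerminal-cost g) ⊕
      bound (≤-trans (bounded (recover-cost π σ (value (bestTerminal g)))) (*-monoʳ-≤ 6 N≤layers))
      where
      T = value (fill 0 nothing σ (value initialize))
      g = proj₁ T
      π = proj₂ T

  -- The routines are variables here: comparing the costs of their instances by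
  -- conversion would unfold the nested loops of the dynamic program.
  sequence-cost : ∀ {A P V R : Set} (ε n : ℚ) (lpr : Timed A) (prof : A → Timed ℤ) (scaled : ℚ → Timed P)
                  (rng : ℚ → ℤ → Timed (ℤ × ℤ)) (srt : Timed V) (dp : P → ℤ → ℤ → V → Timed R)
                  {k₁ k₂ k₃ k₄ k₅ k₆ : ℕ} (W : ℤ → ℤ → ℕ) →
                  (∀ lo hi → 1 ≤ W lo hi) →
                  (∀ lo hi → cost lpr ≤ k₁ ∙ W lo hi) →
                  (∀ S lo hi → cost (prof S) ≤ k₂ ∙ W lo hi) →
                  (∀ s lo hi → cost (scaled s) ≤ k₃ ∙ W lo hi) →
                  (∀ s UB lo hi → cost (rng s UB) ≤ k₄ ∙ W lo hi) →
                  (∀ lo hi → cost srt ≤ k₅ ∙ W lo hi) →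
                  (∀ p̂ lo hi σ → cost (dp p̂ lo hi σ) ≤ k₆ ∙ W lo hi) →
                  let LB = value (prof (value lpr))
                      r  = value (rng ((ε ℚ.* ι LB) ÷₀ n) (+ 3 ℤ.* LB))
                  in
                  cost (do
                    S ← lpr
                    LB ← prof S
                    UB ← ⟦ + 3 ℤ.* LB ⟧
                    εLB ← ⟦ ε ℚ.* ι LB ⟧
                    scale ← ⟦ εLB ÷₀ n ⟧
                    p̂ ← scaled scale
                    (zmin , zmax) ← rng scale UB
                    σ ← srt
                    dp p̂ zmin zmax σ)
                  ≤ k₁ + (k₂ + (3 + (k₃ + (k₄ + (k₅ + k₆))))) ∙ W (proj₁ r) (proj₂ r)
  sequence-cost ε n lpr prof scaled rng srt dp W 1≤W lpr≤ prof≤ scaled≤ rng≤ srt≤ dp≤ =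
    lpr≤ _ _ ⊕ prof≤ _ _ _ ⊕ lit 3 (1≤W _ _) ⊕ scaled≤ _ _ _ ⊕ rng≤ _ _ _ _ ⊕ srt≤ _ _ ⊕ dp≤ _ _ _ _

  -- Cost of the whole algorithm in terms of the table size.

  module F1Cost (I : Instance) (lp : LPSubroutine) (ε : ℚ) where
    open Instance I
    open RoutineCosts I
    open TableSize I

    LB : ℤ
    LB = value (profit I (value (lpRound I lp)))

    scale : ℚ
    scale = (ε ℚ.* ι LB) ÷₀ ιℕ n

    zrange : ℤ × ℤ
    zrange = value (profitRange I scale (+ 3 ℤ.* LB))

    -- Every routine other than the dynamic program is linear or quadratic in `N`, hence below
    -- `layers` whatever the profit range turns out to be.
    F1-cost : Admissible I → cost (F1 I lp ε) ≤ LPSubroutine.K lp + 54 + 124 ∙ layers (proj₁ zrange) (proj₂ zrange)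
    F1-cost adm = sequence-cost ε (ιℕ n) (lpRound I lp) (profit I) (scaledProfits I) (profitRange I)
      (sortByColor I (Vec.allFin n)) (DP.run I) layers
      (λ lo hi → s≤s z≤n)
      (λ lo hi → quadratic lo hi (lpRound-cost lp adm))
      (λ S lo hi → linear lo hi (profit-cost S))
      (λ s lo hi → linear lo hi (scaledProfits-cost s))
      (λ s UB lo hi → linear lo hi (profitRange-cost s UB))
      (λ lo hi → quadratic lo hi (sortAll-cost (Vec.allFin n)))
      (λ p̂ lo hi σ → DPCosts.run-cost I p̂ lo hi σ)
      where
      linear : ∀ {x c} lo hi → x ≤ c ∙ N → x ≤ c ∙ layers lo hi
      linear {c = c} lo hi (bound x≤) = bound (≤-trans x≤ (*-monoʳ-≤ c (N≤layers lo hi)))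

      quadratic : ∀ {x c} lo hi → x ≤ c ∙ N² → x ≤ c ∙ layers lo hi
      quadratic {c = c} lo hi (bound x≤) = bound (≤-trans x≤ (*-monoʳ-≤ c (N²≤layers lo hi)))

open Costs
open _≤_∙_

-- The profit found by LP-Round is at least the maximum profit of an item.

foldr-⊔-lub : ∀ {k} (f : Vector ℤ k) {e u} → e ℤ.≤ u → (∀ i → f i ℤ.≤ u) → foldr ℤ._⊔_ e f ℤ.≤ u
foldr-⊔-lub {zero}  f e≤u f≤u = e≤u
foldr-⊔-lub {suc k} f e≤u f≤u = ℤ.⊔-lub (f≤u zero) (foldr-⊔-lub (f ∘ suc) e≤u (f≤u ∘ suc))

module LowerBound (I : Instance) where
  open Instance I

  best : Fin n
  best = value (mostProfitableItem I)

  -- Invariant of the scan: the profit of the item held never decreases, and after each step it is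
  -- at least that of the item just inspected.
  best-max : ∀ i → p i ℤ.≤ p best
  best-max i = All.lookup (proj₂ (scan (items I) firstItem)) (∈-allFin i)
    where
    -- The loop body, restated so that the induction can run over any list and any starting item.
    step : Fin n → Fin n → Timed (Fin n)
    step i r = lessProfitable I r i >>= λ r<i → if r<i then return i else return r

    step-max : ∀ i r → p r ℤ.≤ p (value (step i r)) × p i ℤ.≤ p (value (step i r))
    step-max i r with p r ℤ.<? p i
    ... | yes r<i = ℤ.<⇒≤ r<i , ℤ.≤-refl
    ... | no  r≮i = ℤ.≤-refl , ℤ.≮⇒≥ r≮i

    scan : ∀ xs r → p r ℤ.≤ p (value (for xs r step)) × All (λ i → p i ℤ.≤ p (value (for xs r step))) xs
    scan []       r = ℤ.≤-refl , []
    scan (x ∷ xs) r =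
      let r≤ , x≤ = step-max x r
          s≤ , xs≤ = scan xs (value (step x r))
      in ℤ.≤-trans r≤ s≤ , ℤ.≤-trans x≤ s≤ ∷ xs≤

  best>0 : Admissible I → 0ℤ ℤ.< p best
  best>0 adm = ℤ.<-≤-trans (Admissible.pmax>0 adm) (foldr-⊔-lub p (best-max firstItem) best-max)

  -- The loop adds `p r` exactly once because `allFin n` contains `r` without repetition; at every
  -- other item the sum is unchanged.
  profit-singleton : ∀ r → value (profit I (value (singleton I r))) ≡ p r
  profit-singleton r = trans (present 0ℤ (allFin⁺ n) (∈-allFin r)) (ℤ.+-identityˡ (p r))
    where
    R = ⊥ [ r ]≔ inside

    step : Fin n → ℤ → Timed ℤ
    step i s = ⟦ lookup R i ⟧ >>= λ i∈S → if i∈S then (⟦ p i ⟧ >>= λ pᵢ → ⟦ s ℤ.+ pᵢ ⟧) else return s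

    step-r : ∀ s → value (step r s) ≡ s ℤ.+ p r
    step-r s rewrite lookup∘update r (⊥ {n}) inside = refl

    step-≢ : ∀ {i} → r ≢ i → ∀ s → value (step i s) ≡ s
    step-≢ {i} r≢i s rewrite lookup∘update′ (r≢i ∘ sym) (⊥ {n}) inside | lookup-replicate i outside = refl

    absent : ∀ {xs} s → All (r ≢_) xs → value (for xs s step) ≡ s
    absent s []           = refl
    absent {x ∷ xs} s (r≢x ∷ r∉xs) = trans (absent (value (step x s)) r∉xs) (step-≢ r≢x s)

    present : ∀ {xs} s → Unique xs → r ∈ xs → value (for xs s step) ≡ s ℤ.+ p r
    present s (r∉xs ∷ _) (here refl) = trans (absent (value (step r s)) r∉xs) (step-r s)
    present {x ∷ xs} s (x∉xs ∷ uxs) (there r∈xs) = trans (present (value (step x s)) uxs r∈xs)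
      (cong (ℤ._+ p r) (step-≢ (All.lookup x∉xs r∈xs ∘ sym) s))

  -- Guaranteed by the final comparison of `lpRound`, for any set `S` left by the repair; hence
  -- `choose` abstracts over that set.
  LB≥best : ∀ lp → p best ℤ.≤ value (profit I (value (lpRound I lp)))
  LB≥best lp = choose (value (repair I (value (integralPart I (value (LPSubroutine.solve lp I))))))
    where
    choose : ∀ S → p best ℤ.≤ value (profit I (value (
      if does (value (profit I S) ℤ.<? p best) then return (value (singleton I best)) else return S)))
    choose S with value (profit I S) ℤ.<? p best
    ... | yes _   = ℤ.≤-reflexive (sym (profit-singleton best))
    ... | no  S≮r = ℤ.≮⇒≥ S≮r

  -- Forces the branch of `profitRange` with `zmin = 0`, the narrower range.
  allNonnegative-true : NonnegativeProfits I → value (allNonnegative I) ≡ true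
  allNonnegative-true p≥0 = scan (items I)
    where
    step : Fin n → Bool → Timed Bool
    step i ok = ⟦ p i ⟧ >>= λ pᵢ → ⟦ does (0ℤ ℤ.≤? pᵢ) ⟧ >>= λ pᵢ≥0 → return (ok ∧ pᵢ≥0)

    scan : ∀ xs → value (for xs true step) ≡ true
    scan []       = refl
    scan (x ∷ xs) rewrite dec-true (0ℤ ℤ.≤? p x) (p≥0 x) = scan xs

-- Range lengths, integers inside the rationals, and rounding.

length-range : ∀ lo hi (P : ℤ → Set) → P 0ℤ → P (ℤ.suc (hi ℤ.- lo)) → P (+ length (range lo hi))
length-range lo hi P p₀ p with ℤ.suc (hi ℤ.- lo)
... | + k          = subst (λ l → P (+ l)) (sym (length-applyUpTo _ k)) p
-- For a negative `hi - lo + 1` the length is cut off at 0, hence the separate assumption on `P 0ℤ`.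
... | ℤ.-[1+ k ] = p₀

-- `ι` normalizes its fraction and does not compute on a variable; in the unnormalized rationals the
-- laws of `ι` become integer identities.
toℚᵘ-ι : ∀ z → toℚᵘ (ι z) ℚᵘ.≃ mkℚᵘ z 0
toℚᵘ-ι z = ℚ.toℚᵘ-fromℚᵘ (mkℚᵘ z 0)

ι-+ : ∀ x y → ι (x ℤ.+ y) ≡ ι x ℚ.+ ι y
ι-+ x y = ℚ.toℚᵘ-injective (begin
  toℚᵘ (ι (x ℤ.+ y))             ≈⟨ toℚᵘ-ι (x ℤ.+ y) ⟩
  mkℚᵘ (x ℤ.+ y) 0               ≈⟨ ℚᵘ.*≡* (shuffle x y) ⟩
  mkℚᵘ x 0 ℚᵘ.+ mkℚᵘ y 0         ≈⟨ ℚᵘ.+-cong (toℚᵘ-ι x) (toℚᵘ-ι y) ⟨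
  toℚᵘ (ι x) ℚᵘ.+ toℚᵘ (ι y)     ≈⟨ ℚ.toℚᵘ-homo-+ (ι x) (ι y) ⟨
  toℚᵘ (ι x ℚ.+ ι y)             ∎)
  where
  open ℚᵘ.≃-Reasoning
  shuffle : ∀ x y → (x ℤ.+ y) ℤ.* (1ℤ) ≡ (x ℤ.* 1ℤ ℤ.+ y ℤ.* 1ℤ) ℤ.* 1ℤ
  shuffle = ℤ.solve-∀

ι-* : ∀ x y → ι (x ℤ.* y) ≡ ι x ℚ.* ι y
ι-* x y = ℚ.toℚᵘ-injective (begin
  toℚᵘ (ι (x ℤ.* y))             ≈⟨ toℚᵘ-ι (x ℤ.* y) ⟩
  mkℚᵘ x 0 ℚᵘ.* mkℚᵘ y 0         ≈⟨ ℚᵘ.*-cong (toℚᵘ-ι x) (toℚᵘ-ι y) ⟨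
  toℚᵘ (ι x) ℚᵘ.* toℚᵘ (ι y)     ≈⟨ ℚ.toℚᵘ-homo-* (ι x) (ι y) ⟨
  toℚᵘ (ι x ℚ.* ι y)             ∎)
  where open ℚᵘ.≃-Reasoning

ι-neg : ∀ x → ι (ℤ.- x) ≡ ℚ.- ι x
ι-neg x = ℚ.toℚᵘ-injective (begin
  toℚᵘ (ι (ℤ.- x))      ≈⟨ toℚᵘ-ι (ℤ.- x) ⟩
  ℚᵘ.- mkℚᵘ x 0         ≈⟨ ℚᵘ.-‿cong (toℚᵘ-ι x) ⟨
  ℚᵘ.- toℚᵘ (ι x)       ≈⟨ ℚ.toℚᵘ-homo‿- (ι x) ⟨
  toℚᵘ (ℚ.- ι x)        ∎)
  where open ℚᵘ.≃-Reasoning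

≤ι : ∀ q z → ↥ q ℤ.≤ z ℤ.* ↧ q → q ℚ.≤ ι z
≤ι q@record{} z h = ℚ.toℚᵘ-cancel-≤ (ℚᵘ.≤-respʳ-≃ (ℚᵘ.≃-sym (toℚᵘ-ι z))
  (ℚᵘ.*≤* (ℤ.≤-trans (ℤ.≤-reflexive (ℤ.*-identityʳ (↥ q))) h)))

ι-mono-≤ : ∀ {x y} → x ℤ.≤ y → ι x ℚ.≤ ι y
ι-mono-≤ {x} {y} x≤y = ℚ.toℚᵘ-cancel-≤ (ℚᵘ.≤-respʳ-≃ (ℚᵘ.≃-sym (toℚᵘ-ι y))
  (ℚᵘ.≤-respˡ-≃ (ℚᵘ.≃-sym (toℚᵘ-ι x)) (ℚᵘ.*≤* (ℤ.*-monoʳ-≤-nonNeg 1ℤ x≤y))))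

ι-mono-< : ∀ {x y} → x ℤ.< y → ι x ℚ.< ι y
ι-mono-< {x} {y} x<y = ℚ.toℚᵘ-cancel-< (ℚᵘ.<-respʳ-≃ (ℚᵘ.≃-sym (toℚᵘ-ι y))
  (ℚᵘ.<-respˡ-≃ (ℚᵘ.≃-sym (toℚᵘ-ι x)) (ℚᵘ.*<* (ℤ.*-monoʳ-<-pos 1ℤ x<y))))

ιℕ-nonNeg : ∀ k → ℚ.NonNegative (ιℕ k)
ιℕ-nonNeg k = ℚ.nonNegative (ι-mono-≤ {0ℤ} {+ k} (ℤ.+≤+ z≤n))

-- Division with remainder: the remainder of the numerator is below the denominator.
≤-floor+1 : ∀ q → q ℚ.≤ ι (floor q) ℚ.+ 1ℚ
≤-floor+1 q@record{} = ℚ.≤-trans (≤ι q (f ℤ.+ 1ℤ) (begin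
  ↥ q                                 ≡⟨ ℤ.a≡a%n+[a/n]*n (↥ q) (↧ q) ⟩
  + (↥ q ℤ.% ↧ q) ℤ.+ f ℤ.* ↧ q       ≤⟨ ℤ.+-monoˡ-≤ (f ℤ.* ↧ q) (ℤ.+≤+ (ℕ.<⇒≤ (ℤ.n%d<d (↥ q) (↧ q)))) ⟩
  ↧ q ℤ.+ f ℤ.* ↧ q                   ≡⟨ shuffle (↧ q) f ⟩
  (f ℤ.+ 1ℤ) ℤ.* ↧ q                  ∎)) (ℚ.≤-reflexive (ι-+ f 1ℤ))
  where
  open ℤ.≤-Reasoning
  f = floor q
  shuffle : ∀ d f → d ℤ.+ f ℤ.* d ≡ (f ℤ.+ 1ℤ) ℤ.* d
  shuffle = ℤ.solve-∀

-- The ceiling is the negated floor of `- q`, so this is the bound on the floor, negated.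
ceiling-≤+1 : ∀ q → ι (ceiling q) ℚ.≤ q ℚ.+ 1ℚ
ceiling-≤+1 q@record{} = begin
  ι (ℤ.- f)                      ≡⟨ ι-neg f ⟩
  ℚ.- ι f                        ≡⟨ shuffle (ι f) 1ℚ ⟩
  ℚ.- (ι f ℚ.+ 1ℚ) ℚ.+ 1ℚ        ≤⟨ ℚ.+-monoˡ-≤ 1ℚ (ℚ.neg-antimono-≤ (≤-floor+1 (ℚ.- q))) ⟩
  ℚ.- (ℚ.- q) ℚ.+ 1ℚ             ≡⟨ double-neg q 1ℚ ⟩
  q ℚ.+ 1ℚ                       ∎
  where
  open ℚ.≤-Reasoning
  f = floor (ℚ.- q)
  shuffle : ∀ a b → ℚ.- a ≡ ℚ.- (a ℚ.+ b) ℚ.+ b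
  shuffle = solve 2 (λ a b → (:- a) := ((:- (a :+ b)) :+ b)) refl where open +-*-Solver
  double-neg : ∀ a b → ℚ.- (ℚ.- a) ℚ.+ b ≡ a ℚ.+ b
  double-neg = solve 2 (λ a b → (:- (:- a)) :+ b := a :+ b) refl where open +-*-Solver

÷₀-* : ∀ x s → s ≢ 0ℚ → (x ÷₀ s) ℚ.* s ≡ x
÷₀-* x s s≢0 with s ℚ.≟ 0ℚ
... | yes s≡0 = contradiction s≡0 s≢0
... | no  s≢0 = ÷-* ⦃ ℚ.≢-nonZero s≢0 ⦄
  where
  ÷-* : .⦃ _ : ℚ.NonZero s ⦄ → (x ℚ.÷ s) ℚ.* s ≡ x
  ÷-* = trans (ℚ.*-assoc x (ℚ.1/ s) s) (trans (cong (x ℚ.*_) (ℚ.*-inverseˡ s)) (ℚ.*-identityʳ x))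

-- Comparing quotients by the scaling factor with powers of n over ε.

module Scaling (n : ℕ) ⦃ _ : NonZero n ⦄ (ε : ℚ) .⦃ ε>0 : Positive ε ⦄ (LB : ℤ) (LB>0 : 0ℤ ℤ.< LB) where

  -- The scaling factor λ of the algorithm.
  s : ℚ
  s = (ε ℚ.* ι LB) ÷₀ ιℕ n

  0<ιn : 0ℚ ℚ.< ιℕ n
  0<ιn = ι-mono-< (ℤ.+<+ (ℕ.>-nonZero⁻¹ n))

  instance
    ιn>0 : Positive (ιℕ n)
    ιn>0 = ℚ.positive 0<ιn

  s*n≡ε*LB : s ℚ.* ιℕ n ≡ ε ℚ.* ι LB
  s*n≡ε*LB = ÷₀-* (ε ℚ.* ι LB) (ιℕ n) (≢-sym (ℚ.<⇒≢ 0<ιn))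

  0<ε*LB : 0ℚ ℚ.< ε ℚ.* ι LB
  0<ε*LB = ℚ.positive⁻¹ _ ⦃ ℚ.pos*pos⇒pos ε (ι LB) ⦃ ℚ.positive (ι-mono-< LB>0) ⦄ ⦄

  0<s*n : 0ℚ ℚ.< s ℚ.* ιℕ n
  0<s*n = subst (0ℚ ℚ.<_) (sym s*n≡ε*LB) 0<ε*LB

  0<s : 0ℚ ℚ.< s
  0<s = ℚ.*-cancelʳ-<-nonNeg (ιℕ n) ⦃ ℚ.pos⇒nonNeg (ιℕ n) ⦄
    (subst (ℚ._< s ℚ.* ιℕ n) (sym (ℚ.*-zeroˡ (ιℕ n))) 0<s*n)

  instance
    s*n>0 : Positive (s ℚ.* ιℕ n)
    s*n>0 = ℚ.positive 0<s*n

  -- The factor `s * n`, equal to `ε * LB`, clears the denominators of both `X / s` and `n ^ e / ε`,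
  -- so that comparing them becomes an integer inequality.
  ÷s-* : ∀ X → (ι X ÷₀ s) ℚ.* (s ℚ.* ιℕ n) ≡ ι (X ℤ.* + n)
  ÷s-* X = begin
    (ι X ÷₀ s) ℚ.* (s ℚ.* ιℕ n)   ≡⟨ ℚ.*-assoc (ι X ÷₀ s) s (ιℕ n) ⟨
    (ι X ÷₀ s) ℚ.* s ℚ.* ιℕ n     ≡⟨ cong (ℚ._* ιℕ n) (÷₀-* (ι X) s (≢-sym (ℚ.<⇒≢ 0<s))) ⟩
    ι X ℚ.* ιℕ n                  ≡⟨ ι-* X (+ n) ⟨
    ι (X ℤ.* + n)                 ∎
    where open ≡-Reasoning

  module _ (e : ℕ) where

    -- The unit in which the number of profit values is measured: `e` is 1 for nonnegative profits
    -- and 2 in general.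
    q : ℚ
    q = n ^ e over ε

    q*ε : q ℚ.* ε ≡ ιℕ (n ℕ.^ e)
    q*ε = trans (ℚ.*-assoc (ιℕ (n ℕ.^ e)) (1/ε) ε) (trans
      (cong (ιℕ (n ℕ.^ e) ℚ.*_) (ℚ.*-inverseˡ ε ⦃ ℚ.pos⇒nonZero ε ⦄)) (ℚ.*-identityʳ _))
      where 1/ε = (ℚ.1/ ε) ⦃ ℚ.pos⇒nonZero ε ⦄

    kq-* : ∀ k → (ι k ℚ.* q) ℚ.* (s ℚ.* ιℕ n) ≡ ι (k ℤ.* + (n ℕ.^ e) ℤ.* LB)
    kq-* k = begin
      (ι k ℚ.* q) ℚ.* (s ℚ.* ιℕ n)             ≡⟨ cong ((ι k ℚ.* q) ℚ.*_) s*n≡ε*LB ⟩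
      (ι k ℚ.* q) ℚ.* (ε ℚ.* ι LB)             ≡⟨ shuffle (ι k) q ε (ι LB) ⟩
      ι k ℚ.* (q ℚ.* ε) ℚ.* ι LB               ≡⟨ cong (λ y → ι k ℚ.* y ℚ.* ι LB) q*ε ⟩
      ι k ℚ.* ιℕ (n ℕ.^ e) ℚ.* ι LB            ≡⟨ cong (ℚ._* ι LB) (ι-* k (+ (n ℕ.^ e))) ⟨
      ι (k ℤ.* + (n ℕ.^ e)) ℚ.* ι LB           ≡⟨ ι-* (k ℤ.* + (n ℕ.^ e)) LB ⟨
      ι (k ℤ.* + (n ℕ.^ e) ℤ.* LB)             ∎
      where
      open ≡-Reasoning
      shuffle : ∀ k q ε b → (k ℚ.* q) ℚ.* (ε ℚ.* b) ≡ k ℚ.* (q ℚ.* ε) ℚ.* b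
      shuffle = solve 4 (λ k q ε b → (k :* q) :* (ε :* b) := k :* (q :* ε) :* b) refl where open +-*-Solver

    ÷s-≤ : ∀ X k → X ℤ.* + n ℤ.≤ k ℤ.* + (n ℕ.^ e) ℤ.* LB → ι X ÷₀ s ℚ.≤ ι k ℚ.* q
    ÷s-≤ X k h = ℚ.*-cancelʳ-≤-pos (s ℚ.* ιℕ n) (begin
      (ι X ÷₀ s) ℚ.* (s ℚ.* ιℕ n)        ≡⟨ ÷s-* X ⟩
      ι (X ℤ.* + n)                      ≤⟨ ι-mono-≤ h ⟩
      ι (k ℤ.* + (n ℕ.^ e) ℤ.* LB)       ≡⟨ kq-* k ⟨
      (ι k ℚ.* q) ℚ.* (s ℚ.* ιℕ n)       ∎)
      where open ℚ.≤-Reasoning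

    ≤-÷s : ∀ X k → k ℤ.* + (n ℕ.^ e) ℤ.* LB ℤ.≤ X ℤ.* + n → ι k ℚ.* q ℚ.≤ ι X ÷₀ s
    ≤-÷s X k h = ℚ.*-cancelʳ-≤-pos (s ℚ.* ιℕ n) (begin
      (ι k ℚ.* q) ℚ.* (s ℚ.* ιℕ n)       ≡⟨ kq-* k ⟩
      ι (k ℤ.* + (n ℕ.^ e) ℤ.* LB)       ≤⟨ ι-mono-≤ h ⟩
      ι (X ℤ.* + n)                      ≡⟨ ÷s-* X ⟨
      (ι X ÷₀ s) ℚ.* (s ℚ.* ιℕ n)        ∎)
      where open ℚ.≤-Reasoning

    -- From `ε < 1 ≤ n ^ e`. It lets additive constants, such as rounding errors, be absorbed into
    -- multiples of `q`.
    1≤q : ε ℚ.< 1ℚ → 1ℚ ℚ.≤ q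
    1≤q ε<1 = ℚ.*-cancelʳ-≤-pos ε (begin
      1ℚ ℚ.* ε         ≡⟨ ℚ.*-identityˡ ε ⟩
      ε                ≤⟨ ℚ.<⇒≤ ε<1 ⟩
      ι 1ℤ             ≤⟨ ι-mono-≤ (ℤ.+≤+ (ℕ.m^n>0 n e)) ⟩
      ιℕ (n ℕ.^ e)     ≡⟨ q*ε ⟨
      q ℚ.* ε          ∎)
      where open ℚ.≤-Reasoning

    n⁴*q : ιℕ (n ℕ.^ 4) ℚ.* q ≡ (n ^ (4 ℕ.+ e) over ε)
    n⁴*q = begin
      ιℕ (n ℕ.^ 4) ℚ.* (ιℕ (n ℕ.^ e) ℚ.* 1/ε)    ≡⟨ ℚ.*-assoc (ιℕ (n ℕ.^ 4)) (ιℕ (n ℕ.^ e)) 1/ε ⟨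
      ιℕ (n ℕ.^ 4) ℚ.* ιℕ (n ℕ.^ e) ℚ.* 1/ε      ≡⟨ cong (ℚ._* 1/ε) (ι-* (+ (n ℕ.^ 4)) (+ (n ℕ.^ e))) ⟨
      ι (+ (n ℕ.^ 4) ℤ.* + (n ℕ.^ e)) ℚ.* 1/ε    ≡⟨ cong (λ z → ι z ℚ.* 1/ε) (ℤ.pos-* (n ℕ.^ 4) (n ℕ.^ e)) ⟨
      ιℕ (n ℕ.^ 4 ℕ.* n ℕ.^ e) ℚ.* 1/ε           ≡⟨ cong (λ z → ιℕ z ℚ.* 1/ε) (ℕ.^-distribˡ-+-* n 4 e) ⟨
      ιℕ (n ℕ.^ (4 ℕ.+ e)) ℚ.* 1/ε               ∎
      where
      open ≡-Reasoning
      1/ε = (ℚ.1/ ε) ⦃ ℚ.pos⇒nonZero ε ⦄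

-- Number of profit values and the resulting running time.

open import Data.Rational.Base using (_<_; _≤_; _*_)

module RangeBound (I : Instance) (adm : Admissible I) (lp : LPSubroutine)
                  (ε : ℚ) .⦃ ε>0 : Positive ε ⦄ (ε<1 : ε < 1ℚ) where
  open Instance I
  open LowerBound I
  open F1Cost I lp ε using (LB; zrange)

  P : ℤ
  P = p best

  P≤LB : P ℤ.≤ LB
  P≤LB = LB≥best lp

  0≤P : 0ℤ ℤ.≤ P
  0≤P = ℤ.<⇒≤ (best>0 adm)

  LB>0 : 0ℤ ℤ.< LB
  LB>0 = ℤ.<-≤-trans (best>0 adm) P≤LB

  open Scaling n ε LB LB>0

  module _ (e : ℕ) (n≤nᵉ : n ℕ.≤ n ℕ.^ e) where

    -- One pair of bounds for both branches of `profitRange`. In the general one, `UB` contributes 3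
    -- and the maximum profit times `n` contributes 1 to the factor 4, and 1 to the factor below;
    -- the summands `1ℚ` allow for rounding.
    Within : ℤ × ℤ → Set
    Within (lo , hi) = ι -1ℤ * q e ≤ ι lo ℚ.+ 1ℚ × ι hi ≤ ι (+ 4) * q e ℚ.+ 1ℚ

    0≤LB : 0ℤ ℤ.≤ LB
    0≤LB = ℤ.<⇒≤ LB>0

    -- The integer form of `UB / s ≤ 3 q`.
    3LB*n≤ : (+ 3 ℤ.* LB) ℤ.* + n ℤ.≤ + 3 ℤ.* + (n ℕ.^ e) ℤ.* LB
    3LB*n≤ = begin
      (+ 3 ℤ.* LB) ℤ.* + n                  ≡⟨ shuffle (+ 3) LB (+ n) ⟩
      + 3 ℤ.* (+ n ℤ.* LB)                  ≤⟨ ℤ.*-monoˡ-≤-nonNeg (+ 3) (ℤ.*-monoʳ-≤-nonNeg LB ⦃ ℤ.nonNegative 0≤LB ⦄ (ℤ.+≤+ n≤nᵉ)) ⟩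
      + 3 ℤ.* (+ (n ℕ.^ e) ℤ.* LB)          ≡⟨ ℤ.*-assoc (+ 3) (+ (n ℕ.^ e)) LB ⟨
      + 3 ℤ.* + (n ℕ.^ e) ℤ.* LB            ∎
      where
      open ℤ.≤-Reasoning
      shuffle : ∀ a b c → (a ℤ.* b) ℤ.* c ≡ a ℤ.* (c ℤ.* b)
      shuffle = ℤ.solve-∀

    ceiling÷s≤ : ∀ X → X ℤ.* + n ℤ.≤ + 4 ℤ.* + (n ℕ.^ e) ℤ.* LB →
                 ι (ceiling (ι X ÷₀ s)) ≤ ι (+ 4) * q e ℚ.+ 1ℚ
    ceiling÷s≤ X h = ℚ.≤-trans (ceiling-≤+1 (ι X ÷₀ s)) (ℚ.+-monoˡ-≤ 1ℚ (÷s-≤ e X (+ 4) h))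

    nonnegative-within : Within (0ℤ , ceiling (ι (+ 3 ℤ.* LB) ÷₀ s))
    nonnegative-within =
      -- Here `zmin` is 0: `- q ≤ -1` since `1 ≤ q`, and `-1 ≤ 0 + 1` is decided by evaluation.
      ℚ.≤-trans (ℚ.*-monoˡ-≤-nonPos (ι -1ℤ) (1≤q e ε<1)) (toWitness {a? = ι -1ℤ * 1ℚ ℚ.≤? ι 0ℤ ℚ.+ 1ℚ} _) ,
      ceiling÷s≤ (+ 3 ℤ.* LB) (ℤ.≤-trans 3LB*n≤ (ℤ.*-monoʳ-≤-nonNeg LB ⦃ ℤ.nonNegative 0≤LB ⦄
        (ℤ.*-monoʳ-≤-nonNeg (+ (n ℕ.^ e)) (ℤ.+≤+ (ℕ.n≤1+n 3)))))

    general-within : n ℕ.* n ℕ.≤ n ℕ.^ e →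
      Within (floor (ι (ℤ.- (+ n ℤ.* P)) ÷₀ s) , ceiling (ι (+ 3 ℤ.* LB ℤ.+ + n ℤ.* P) ÷₀ s))
    general-within n²≤nᵉ =
      ℚ.≤-trans (≤-÷s e (ℤ.- (+ n ℤ.* P)) -1ℤ lower) (≤-floor+1 (ι (ℤ.- (+ n ℤ.* P)) ÷₀ s)) ,
      ceiling÷s≤ (+ 3 ℤ.* LB ℤ.+ + n ℤ.* P) upper
      where
      open ℤ.≤-Reasoning
      M = + (n ℕ.^ e)

      -- The integer form of `n P / s ≤ q`, from `P ≤ LB` and `n * n ≤ n ^ e`; it serves both ends
      -- of the range.
      nP*n≤ : (+ n ℤ.* P) ℤ.* + n ℤ.≤ M ℤ.* LB
      nP*n≤ = begin
        (+ n ℤ.* P) ℤ.* + n     ≡⟨ shuffle (+ n) P ⟩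
        (+ n ℤ.* + n) ℤ.* P     ≡⟨ cong (ℤ._* P) (ℤ.pos-* n n) ⟨
        + (n ℕ.* n) ℤ.* P       ≤⟨ ℤ.*-monoʳ-≤-nonNeg P ⦃ ℤ.nonNegative 0≤P ⦄ (ℤ.+≤+ n²≤nᵉ) ⟩
        M ℤ.* P                 ≤⟨ ℤ.*-monoˡ-≤-nonNeg M P≤LB ⟩
        M ℤ.* LB                ∎
        where
        shuffle : ∀ a b → (a ℤ.* b) ℤ.* a ≡ (a ℤ.* a) ℤ.* b
        shuffle = ℤ.solve-∀

      lower : -1ℤ ℤ.* M ℤ.* LB ℤ.≤ (ℤ.- (+ n ℤ.* P)) ℤ.* + n
      lower = begin
        -1ℤ ℤ.* M ℤ.* LB                ≡⟨ shuffle₁ M LB ⟩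
        ℤ.- (M ℤ.* LB)                  ≤⟨ ℤ.neg-mono-≤ nP*n≤ ⟩
        ℤ.- ((+ n ℤ.* P) ℤ.* + n)       ≡⟨ ℤ.neg-distribˡ-* (+ n ℤ.* P) (+ n) ⟩
        (ℤ.- (+ n ℤ.* P)) ℤ.* + n       ∎
        where
        shuffle₁ : ∀ a b → -1ℤ ℤ.* a ℤ.* b ≡ ℤ.- (a ℤ.* b)
        shuffle₁ = ℤ.solve-∀

      upper : (+ 3 ℤ.* LB ℤ.+ + n ℤ.* P) ℤ.* + n ℤ.≤ + 4 ℤ.* M ℤ.* LB
      upper = begin
        (+ 3 ℤ.* LB ℤ.+ + n ℤ.* P) ℤ.* + n                    ≡⟨ ℤ.*-distribʳ-+ (+ n) (+ 3 ℤ.* LB) (+ n ℤ.* P) ⟩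
        (+ 3 ℤ.* LB) ℤ.* + n ℤ.+ (+ n ℤ.* P) ℤ.* + n          ≤⟨ ℤ.+-mono-≤ 3LB*n≤ nP*n≤ ⟩
        + 3 ℤ.* M ℤ.* LB ℤ.+ M ℤ.* LB                         ≡⟨ shuffle M LB ⟩
        + 4 ℤ.* M ℤ.* LB                                      ∎
        where
        shuffle : ∀ a b → + 3 ℤ.* a ℤ.* b ℤ.+ a ℤ.* b ≡ + 4 ℤ.* a ℤ.* b
        shuffle = ℤ.solve-∀

    -- The general branch needs `n * n ≤ n ^ e`; otherwise the test for nonnegative profits must be
    -- known to succeed.
    zrange-within : value (allNonnegative I) ≡ true ⊎ n ℕ.* n ℕ.≤ n ℕ.^ e → Within zrange
    zrange-within = choose (value (allNonnegative I))
      where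
      choose : ∀ β {c₁ c₂} → β ≡ true ⊎ n ℕ.* n ℕ.≤ n ℕ.^ e →
        Within (value (if β
          then (0ℤ , ceiling (ι (+ 3 ℤ.* LB) ÷₀ s)) costing c₁
          else ((floor (ι (ℤ.- (+ n ℤ.* P)) ÷₀ s) , ceiling (ι (+ 3 ℤ.* LB ℤ.+ + n ℤ.* P) ÷₀ s)) costing c₂)))
      choose true  _            = nonnegative-within
      choose false (inj₂ n²≤nᵉ) = general-within n²≤nᵉ

    -- `Within` gives `hi - lo + 2 ≤ 5 q + 4`, and `1 ≤ q` turns the 4 into `4 q`.
    1+length≤9q : ∀ lo hi → Within (lo , hi) → ιℕ (suc (length (range lo hi))) ≤ ι (+ 9) * q e
    1+length≤9q lo hi (lo≥ , hi≤) = length-range lo hi (λ z → ι (ℤ.suc z) ≤ ι (+ 9) * q e)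
      -- The case of length 0: `1 ≤ 9 ≤ 9 q`.
      (ℚ.≤-trans (toWitness {a? = ι (+ 1) ℚ.≤? ι (+ 9) * 1ℚ} _) (ℚ.*-monoˡ-≤-nonNeg (ι (+ 9)) (1≤q e ε<1)))
      (begin
        ι (ℤ.suc (ℤ.suc (hi ℤ.- lo)))
          ≡⟨ cong ι (shuffle₁ hi lo) ⟩
        ι (+ 3 ℤ.+ (hi ℤ.- (lo ℤ.+ 1ℤ)))
          ≡⟨ ι-+ (+ 3) (hi ℤ.- (lo ℤ.+ 1ℤ)) ⟩
        ι (+ 3) ℚ.+ ι (hi ℤ.- (lo ℤ.+ 1ℤ))
          ≡⟨ cong (ι (+ 3) ℚ.+_) (ι-+ hi (ℤ.- (lo ℤ.+ 1ℤ))) ⟩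
        ι (+ 3) ℚ.+ (ι hi ℚ.+ ι (ℤ.- (lo ℤ.+ 1ℤ)))
          ≡⟨ cong (λ y → ι (+ 3) ℚ.+ (ι hi ℚ.+ y)) (trans (ι-neg (lo ℤ.+ 1ℤ)) (cong ℚ.-_ (ι-+ lo 1ℤ))) ⟩
        ι (+ 3) ℚ.+ (ι hi ℚ.- (ι lo ℚ.+ 1ℚ))
          ≤⟨ ℚ.+-monoʳ-≤ (ι (+ 3)) (ℚ.+-mono-≤ hi≤ (ℚ.neg-antimono-≤ lo≥)) ⟩
        ι (+ 3) ℚ.+ ((ι (+ 4) * q e ℚ.+ 1ℚ) ℚ.- ι -1ℤ * q e)
          ≡⟨ shuffle₂ (q e) ⟩
        ι (+ 4) * 1ℚ ℚ.+ ι (+ 5) * q e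
          ≤⟨ ℚ.+-monoˡ-≤ (ι (+ 5) * q e) (ℚ.*-monoˡ-≤-nonNeg (ι (+ 4)) (1≤q e ε<1)) ⟩
        ι (+ 4) * q e ℚ.+ ι (+ 5) * q e
          ≡⟨ ℚ.*-distribʳ-+ (q e) (ι (+ 4)) (ι (+ 5)) ⟨
        ι (+ 9) * q e ∎)
      where
      open ℚ.≤-Reasoning
      shuffle₁ : ∀ a b → 1ℤ ℤ.+ (1ℤ ℤ.+ (a ℤ.+ ℤ.- b)) ≡ + 3 ℤ.+ (a ℤ.+ ℤ.- (b ℤ.+ 1ℤ))
      shuffle₁ = ℤ.solve-∀
      shuffle₂ : ∀ q → ι (+ 3) ℚ.+ ((ι (+ 4) * q ℚ.+ 1ℚ) ℚ.- ι -1ℤ * q) ≡ ι (+ 4) * 1ℚ ℚ.+ ι (+ 5) * q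
      shuffle₂ = solve 1 (λ q →
        con (ι (+ 3)) :+ ((con (ι (+ 4)) :* q :+ con 1ℚ) :- con (ι -1ℤ) :* q) :=
        con (ι (+ 4)) :* con 1ℚ :+ con (ι (+ 5)) :* q) refl
        where open +-*-Solver

    -- 178 collects the constants 54 and 124 of `F1-cost`. Since `n` is positive, `n + 1 ≤ 2 n`, so
    -- the fourth power costs a factor 16; with the 9 of `1+length≤9q` this makes 144.
    runningTime-bound : value (allNonnegative I) ≡ true ⊎ n ℕ.* n ℕ.≤ n ℕ.^ e →
      ιℕ (runningTime I lp ε) ≤ ιℕ ((LPSubroutine.K lp ℕ.+ 178) ℕ.* 144) * (n ^ (4 ℕ.+ e) over ε)
    runningTime-bound h = begin
      ιℕ (runningTime I lp ε)
        ≤⟨ ι-mono-≤ (ℤ.+≤+ (ℕ.≤-trans (bounded (F1Cost.F1-cost I lp ε adm)) layers≤)) ⟩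
      ιℕ (D ℕ.* 16 ℕ.* n ℕ.^ 4 ℕ.* L)
        ≡⟨ ι-*ℕ (D ℕ.* 16 ℕ.* n ℕ.^ 4) L ⟩
      ιℕ (D ℕ.* 16 ℕ.* n ℕ.^ 4) * ιℕ L
        ≤⟨ ℚ.*-monoˡ-≤-nonNeg (ιℕ (D ℕ.* 16 ℕ.* n ℕ.^ 4)) ⦃ ιℕ-nonNeg (D ℕ.* 16 ℕ.* n ℕ.^ 4) ⦄
             (1+length≤9q (proj₁ zrange) (proj₂ zrange) (zrange-within h)) ⟩
      ιℕ (D ℕ.* 16 ℕ.* n ℕ.^ 4) * (ιℕ 9 * q e)
        ≡⟨ cong (_* (ιℕ 9 * q e)) (ι-*ℕ (D ℕ.* 16) (n ℕ.^ 4)) ⟩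
      ιℕ (D ℕ.* 16) * ιℕ (n ℕ.^ 4) * (ιℕ 9 * q e)
        ≡⟨ shuffle (ιℕ (D ℕ.* 16)) (ιℕ (n ℕ.^ 4)) (ιℕ 9) (q e) ⟩
      ιℕ (D ℕ.* 16) * ιℕ 9 * (ιℕ (n ℕ.^ 4) * q e)
        ≡⟨ cong₂ _*_ (trans (sym (ι-*ℕ (D ℕ.* 16) 9)) (cong ιℕ (ℕ.*-assoc D 16 9))) (n⁴*q e) ⟩
      ιℕ (D ℕ.* 144) * (n ^ (4 ℕ.+ e) over ε) ∎
      where
      open ℚ.≤-Reasoning
      D = LPSubroutine.K lp ℕ.+ 178
      L = suc (length (range (proj₁ zrange) (proj₂ zrange)))

      ι-*ℕ : ∀ a b → ιℕ (a ℕ.* b) ≡ ιℕ a * ιℕ b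
      ι-*ℕ a b = trans (cong ι (ℤ.pos-* a b)) (ι-* (+ a) (+ b))

      shuffle : ∀ a b c d → a * b * (c * d) ≡ a * c * (b * d)
      shuffle = solve 4 (λ a b c d → a :* b :* (c :* d) := a :* c :* (b :* d)) refl where open +-*-Solver

      N≤2n : suc n ℕ.≤ n ℕ.+ n
      N≤2n = ℕ.+-monoˡ-≤ n (ℕ.>-nonZero⁻¹ n)

      layers≤ : (LPSubroutine.K lp ℕ.+ 54 ℕ.+ 124) ℕ.* (L ℕ.* suc n ℕ.* suc n ℕ.* suc n ℕ.* suc n) ℕ.≤
                D ℕ.* 16 ℕ.* n ℕ.^ 4 ℕ.* L
      layers≤ = ℕ.≤-trans
        (ℕ.*-mono-≤ (ℕ.≤-reflexive (ℕ.+-assoc (LPSubroutine.K lp) 54 124))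
          (ℕ.*-mono-≤ (ℕ.*-mono-≤ (ℕ.*-mono-≤ (ℕ.*-monoʳ-≤ L N≤2n) N≤2n) N≤2n) N≤2n))
        (ℕ.≤-reflexive (expand D L n))
        where
        -- `n ^ 4` appears as the product it unfolds to.
        expand : ∀ d l n → d ℕ.* (l ℕ.* (n ℕ.+ n) ℕ.* (n ℕ.+ n) ℕ.* (n ℕ.+ n) ℕ.* (n ℕ.+ n)) ≡
                           d ℕ.* 16 ℕ.* (n ℕ.* (n ℕ.* (n ℕ.* (n ℕ.* 1)))) ℕ.* l
        expand = ℕ.solve-∀

theorem5p2 : ∀ (lp : LPSubroutine) →
    (∃[ C ] ∀ (I : Instance) (ε : ℚ) .⦃ ε>0 : Positive ε ⦄ → ε < 1ℚ →
      Admissible I → NonnegativeProfits I →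
      ιℕ (runningTime I lp ε) ≤ ιℕ C * (Instance.n I ^ 5 over ε))
    ×
    (∃[ C ] ∀ (I : Instance) (ε : ℚ) .⦃ ε>0 : Positive ε ⦄ → ε < 1ℚ →
      Admissible I →
      ιℕ (runningTime I lp ε) ≤ ιℕ C * (Instance.n I ^ 6 over ε))
theorem5p2 lp =
  -- `e = 1`: the general branch is excluded by the sign of the profits.
  (C , λ I ε ε<1 adm p≥0 → let n = Instance.n I in
    RangeBound.runningTime-bound I adm lp ε ε<1 1 (ℕ.≤-reflexive (sym (ℕ.^-identityʳ n)))
      (inj₁ (LowerBound.allNonnegative-true I p≥0))) ,
  -- `e = 2`: `n * n ≤ n ^ 2` admits both branches, and also yields `n ≤ n ^ 2`.
  (C , λ I ε ε<1 adm → let n = Instance.n I; n²≡ = cong (n ℕ.*_) (sym (ℕ.*-identityʳ n)) in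
    RangeBound.runningTime-bound I adm lp ε ε<1 2
      (ℕ.≤-trans (ℕ.m≤m*n n n) (ℕ.≤-reflexive n²≡)) (inj₂ (ℕ.≤-reflexive n²≡)))
  where C = (LPSubroutine.K lp ℕ.+ 178) ℕ.* 144
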